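{- Let $n \geq 0$. A path $w \in P(n,n)$ is idempotent (i.e. $w \otimes w = w$) if and only if it is an upper zigzag.
   Context: $P(n,m)$ denotes the set of words $w \in \{x,y\}^{*}$ with exactly $n$ occurrences of $x$ and $m$ occurrences of $y$; such a word is identified with the lattice path from $(0,0)$ to $(n,m)$ where $x$ is a unit East step and $y$ is a unit North step. Blocks: the $m$ occurrences of $y$ split $w\in P(n,m)$ into $m+1$ (possibly empty) words $\mathbf{bl}^{w,x}_0,\ldots,\mathbf{bl}^{w,x}_m \in \{x\}^{*}$ with $w = \mathbf{bl}^{w,x}_0 \, y\, \mathbf{bl}^{w,x}_1\, y \cdots y\, \mathbf{bl}^{w,x}_m$; similarly the $n$ occurrences of $x$ split $w$ into words $\mathbf{bl}^{w,y}_0,\ldots,\mathbf{bl}^{w,y}_n \in \{y\}^{*}$ with $w = \mathbf{bl}^{w,y}_0\, x\, \mathbf{bl}^{w,y}_1\, x\cdots x\, \mathbf{bl}^{w,y}_n$. Product: for $w \in P(n,m)$ and $u \in P(m,k)$, $w \otimes u := \mathbf{bl}^{w,x}_0\, \mathbf{bl}^{u,y}_0\, \mathbf{bl}^{w,x}_1\, \mathbf{bl}^{u,y}_1 \cdots \mathbf{bl}^{w,x}_m\, \mathbf{bl}^{u,y}_m \in P(n,k)$. Turns: if $w = w_0 w_1$ where $w_0$ ends with $y$ and $w_1$ begins with $x$, then $w$ has a North-East turn at the point $(a,b)$, where $a$ and $b$ are the numbers of $x$'s and $y$'s in $w_0$; if $w_0$ ends with $x$ and $w_1$ begins with $y$,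 then $w$ has an East-North turn at the point $(a,b)$, defined in the same way. A path is an upper zigzag if each of its North-East turns is above the line $y = x + \frac12$ and each of its East-North turns is below this line; equivalently, every North-East turn $(a,b)$ satisfies $a < b$ and every East-North turn $(a,b)$ satisfies $b \leq a$. -}

module Defs where

open import Algebra.Properties.CommutativeSemigroup using (interchange)
open import Data.Integer.Base as ℤ using ()
open import Data.List.Base using (List; []; _∷_; _++_; concat; filter; head; last; length)
open import Data.List.Properties using (filter-++; length-++)
open import Data.Maybe.Base using (just)
open import Data.Nat.Base using (ℕ; suc; _+_)
open import Data.Nat.Properties using (+-commutativeSemigroup; +-identityʳ)
open import Data.Product.Base using (_×_; ∃₂)
open import Data.Rational.Unnormalised.Base as ℚᵘ using (ℚᵘ; ½)
open import Data.Vec.Base using (Vec; []; _∷_; cast; toList; zipWith)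
open import Data.Vec.Properties using (toList-cast)
open import Relation.Binary.Definitions using (DecidableEquality)
open import Relation.Binary.PropositionalEquality
  using (_≡_; _≢_; refl; sym; trans; cong; cong₂; module ≡-Reasoning)
open import Relation.Nullary.Decidable.Core using (yes; no)
open import Relation.Nullary.Negation.Core using (contradiction)

data Letter : Set where
  x y : Letter

_≟_ : DecidableEquality Letter
x ≟ x = yes refl
x ≟ y = no λ ()
y ≟ x = no λ ()
y ≟ y = yes refl

Word : Set
Word = List Letter

occ : Letter → Word → ℕ
occ c w = length (filter (c ≟_) w)

-- The counting proofs are irrelevant, so equality in P n m is equality of words.
record P (n m : ℕ) : Set where
  constructor mkP
  field
    word  : Word
    .occˣ : occ x word ≡ n
    .occʸ : occ y word ≡ m

open P public using (word)

consHead : ∀ {k} → Letter → Vec Word (suc k) → Vec Word (suc k)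
consHead d (v ∷ vs) = (d ∷ v) ∷ vs

-- The (possibly empty) words between consecutive occurrences of c.
split : (c : Letter) (w : Word) → Vec Word (suc (occ c w))
split c []      = [] ∷ []
split c (d ∷ w) with c ≟ d
... | yes _ = [] ∷ split c w
... | no  _ = consHead d (split c w)

-- The blocks of x's are cut out by the occurrences of y, and vice versa.
blˣ : ∀ {n m} → P n m → Vec Word (suc m)
blˣ (mkP w _ q) = cast (cong suc q) (split y w)

blʸ : ∀ {n m} → P n m → Vec Word (suc n)
blʸ (mkP w p _) = cast (cong suc p) (split x w)

flatten : ∀ {k} → Vec Word k → Word
flatten vs = concat (toList vs)

interleave : ∀ {k} → Vec Word k → Vec Word k → Word
interleave vs us = flatten (zipWith _++_ vs us)

occ-++ : ∀ c v w → occ c (v ++ w) ≡ occ c v + occ c w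
occ-++ c v w = trans (cong length (filter-++ (c ≟_) v w)) (length-++ (filter (c ≟_) v))

occ-interleave : ∀ c {k} (vs us : Vec Word k) →
                 occ c (interleave vs us) ≡ occ c (flatten vs) + occ c (flatten us)
occ-interleave c []       []       = refl
occ-interleave c (v ∷ vs) (u ∷ us) = begin
  occ c ((v ++ u) ++ interleave vs us)
    ≡⟨ occ-++ c (v ++ u) (interleave vs us) ⟩
  occ c (v ++ u) + occ c (interleave vs us)
    ≡⟨ cong₂ _+_ (occ-++ c v u) (occ-interleave c vs us) ⟩
  (occ c v + occ c u) + (occ c (flatten vs) + occ c (flatten us))
    ≡⟨ interchange +-commutativeSemigroup (occ c v) (occ c u) (occ c (flatten vs)) (occ c (flatten us)) ⟩
  (occ c v + occ c (flatten vs)) + (occ c u + occ c (flatten us))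
    ≡⟨ sym (cong₂ _+_ (occ-++ c v (flatten vs)) (occ-++ c u (flatten us))) ⟩
  occ c (v ++ flatten vs) + occ c (u ++ flatten us) ∎
  where open ≡-Reasoning

flatten-consHead : ∀ d {k} (vs : Vec Word (suc k)) → flatten (consHead d vs) ≡ d ∷ flatten vs
flatten-consHead d (v ∷ vs) = refl

occ-split-same : ∀ c w → occ c (flatten (split c w)) ≡ 0
occ-split-same c []      = refl
occ-split-same c (d ∷ w) with c ≟ d in eq
... | yes _ = occ-split-same c w
... | no  _ rewrite flatten-consHead d (split c w) | eq = occ-split-same c w

occ-split-other : ∀ {c d} → d ≢ c → ∀ w → occ d (flatten (split c w)) ≡ occ d w
occ-split-other d≢c []      = refl
occ-split-other {c} {d} d≢c (e ∷ w) with c ≟ e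
... | no _ rewrite flatten-consHead e (split c w) with d ≟ e
...   | yes _ = cong suc (occ-split-other d≢c w)
...   | no  _ = occ-split-other d≢c w
occ-split-other {c} {d} d≢c (e ∷ w) | yes refl with d ≟ c
...   | yes d≡c = contradiction d≡c d≢c
...   | no  _   = occ-split-other d≢c w

flatten-cast : ∀ {k l} .(eq : k ≡ l) (vs : Vec Word k) → flatten (cast eq vs) ≡ flatten vs
flatten-cast eq vs = cong concat (toList-cast eq vs)

occ-product : ∀ c {k l m} .(p : k ≡ m) .(q : l ≡ m) (vs : Vec Word k) (us : Vec Word l) →
              occ c (interleave (cast p vs) (cast q us)) ≡ occ c (flatten vs) + occ c (flatten us)
occ-product c p q vs us = trans
  (occ-interleave c (cast p vs) (cast q us))
  (cong₂ _+_ (cong (occ c) (flatten-cast p vs)) (cong (occ c) (flatten-cast q us)))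

infixl 7 _⊗_

_⊗_ : ∀ {n m k} → P n m → P m k → P n k
w@(mkP v p q) ⊗ u@(mkP t r s) = mkP (interleave (blˣ w) (blʸ u))
  (trans (occ-product x (cong suc q) (cong suc r) (split y v) (split x t))
    (trans (cong₂ _+_ (occ-split-other (λ ()) v) (occ-split-same x t))
      (trans (+-identityʳ (occ x v)) p)))
  (trans (occ-product y (cong suc q) (cong suc r) (split y v) (split x t))
    (trans (cong₂ _+_ (occ-split-same y v) (occ-split-other (λ ()) t)) s))

Turn : Letter → Letter → Word → ℕ → ℕ → Set
Turn c d w a b = ∃₂ λ w₀ w₁ →
  w ≡ w₀ ++ w₁ × last w₀ ≡ just c × head w₁ ≡ just d × occ x w₀ ≡ a × occ y w₀ ≡ b

NorthEastTurn EastNorthTurn : Word → ℕ → ℕ → Set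
NorthEastTurn = Turn y x
EastNorthTurn = Turn x y

fromℕ : ℕ → ℚᵘ
fromℕ a = ℤ.+ a ℚᵘ./ 1

-- The position of the point (a , b) relative to the line y = x + ½.
AboveLine BelowLine : ℕ → ℕ → Set
AboveLine a b = fromℕ a ℚᵘ.+ ½ ℚᵘ.< fromℕ b
BelowLine a b = fromℕ b ℚᵘ.< fromℕ a ℚᵘ.+ ½

UpperZigzag : ∀ {n m} → P n m → Set
UpperZigzag w =
  (∀ a b → NorthEastTurn (word w) a b → AboveLine a b) ×
  (∀ a b → EastNorthTurn (word w) a b → BelowLine a b)

{-# OPTIONS --safe #-}
-- Encode a word w by the function i ↦ number of x's before the y of index i ≥ 0,
-- extended by the total number of x's once the y's run out. The product of words
-- becomes composition of these monotone functions, so w is idempotent iff its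
-- function g is. A North-East turn is a point (g b , b + 1) with g b < g (b + 1),
-- an East-North turn a point (g b , b) at which the value g b is reached first.
-- Hence every value v of g is constant on an interval of arguments whose ends are
-- marked by the turns with abscissa v, and the zigzag condition says that v lies in
-- this interval, i.e. that g v = v.
module Submission where

open import Defs
open import Data.Integer.Base as ℤ using (+_; +<+)
open import Data.Integer.Properties using (pos-*; drop‿+<+) renaming (*-identityʳ to ℤ-*-identityʳ)
open import Data.List.Base using ([]; _∷_; [_]; _++_; concat; last; zipWith)
open import Data.List.Properties using (++-assoc)
open import Data.Maybe.Base using (just)
open import Data.Nat.Base using (ℕ; zero; suc; _+_; _*_; _≤_; _<_; z≤n; s≤s; s≤s⁻¹)
open import Data.Nat.Properties as ℕ hiding (_≟_)
open import Data.Product.Base using (_×_; _,_; ∃; ∃₂)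
open import Data.Rational.Unnormalised.Base as ℚᵘ using (*<*; ½)
open import Data.Vec.Base using (Vec; []; _∷_; toList)
open import Data.Vec.Properties using (toList-cast)
open import Function.Base using (_∘_)
open import Function.Bundles using (_⇔_; mk⇔; Equivalence)
open import Relation.Binary.PropositionalEquality
  using (_≡_; refl; sym; trans; cong; cong₂; subst; subst₂)
open import Relation.Nullary.Decidable.Core using (recompute; yes; no)
open import Relation.Nullary.Negation.Core using (contradiction)

xsBefore : Word → ℕ → ℕ
xsBefore []      i       = 0
xsBefore (x ∷ w) i       = suc (xsBefore w i)
xsBefore (y ∷ w) zero    = 0
xsBefore (y ∷ w) (suc i) = xsBefore w i

xsBefore-mono : ∀ w {i j} → i ≤ j → xsBefore w i ≤ xsBefore w j
xsBefore-mono []      i≤j       = z≤n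
xsBefore-mono (x ∷ w) i≤j       = s≤s (xsBefore-mono w i≤j)
xsBefore-mono (y ∷ w) z≤n       = z≤n
xsBefore-mono (y ∷ w) (s≤s i≤j) = xsBefore-mono w i≤j

xsBefore-≤ : ∀ w i → xsBefore w i ≤ occ x w
xsBefore-≤ []      i       = z≤n
xsBefore-≤ (x ∷ w) i       = s≤s (xsBefore-≤ w i)
xsBefore-≤ (y ∷ w) zero    = z≤n
xsBefore-≤ (y ∷ w) (suc i) = xsBefore-≤ w i

xsBefore-total : ∀ w {i} → occ y w ≤ i → xsBefore w i ≡ occ x w
xsBefore-total []      _       = refl
xsBefore-total (x ∷ w) p       = cong suc (xsBefore-total w p)
xsBefore-total (y ∷ w) (s≤s p) = xsBefore-total w p

xsBefore-++ : ∀ p q i → xsBefore (p ++ q) (occ y p + i) ≡ occ x p + xsBefore q i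
xsBefore-++ []      q i = refl
xsBefore-++ (x ∷ p) q i = cong suc (xsBefore-++ p q i)
xsBefore-++ (y ∷ p) q i = xsBefore-++ p q i

-- The `y` of index `i` already lies in `p`, hence so does every `x` before it.
xsBefore-++-≤ : ∀ p q {i} → i < occ y p → xsBefore (p ++ q) i ≤ occ x p
xsBefore-++-≤ (x ∷ p) q         i<p       = s≤s (xsBefore-++-≤ p q i<p)
xsBefore-++-≤ (y ∷ p) q {zero}  _         = z≤n
xsBefore-++-≤ (y ∷ p) q {suc i} (s≤s i<p) = xsBefore-++-≤ p q i<p

-- `xsBefore` does not see trailing `y`'s, so the equal `y`-counts settle where a word ends. Words
-- with different first letters are told apart by the value at 0.
xsBefore-injective : ∀ v w → occ y v ≡ occ y w → (∀ i → xsBefore v i ≡ xsBefore w i) → v ≡ w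
xsBefore-injective []      []      _  _ = refl
xsBefore-injective []      (x ∷ w) _  h = contradiction (h 0) λ ()
xsBefore-injective (x ∷ v) []      _  h = contradiction (h 0) λ ()
xsBefore-injective (x ∷ v) (x ∷ w) eq h =
  cong (x ∷_) (xsBefore-injective v w eq (suc-injective ∘ h))
xsBefore-injective (x ∷ v) (y ∷ w) _  h = contradiction (h 0) λ ()
xsBefore-injective (y ∷ v) (x ∷ w) _  h = contradiction (h 0) λ ()
xsBefore-injective (y ∷ v) (y ∷ w) eq h =
  cong (y ∷_) (xsBefore-injective v w (suc-injective eq) (h ∘ suc))

interleave-toList : ∀ {k} (vs us : Vec Word k) →
                    interleave vs us ≡ concat (zipWith _++_ (toList vs) (toList us))
interleave-toList []       []       = refl
interleave-toList (v ∷ vs) (u ∷ us) = cong ((v ++ u) ++_) (interleave-toList vs us)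

-- The product on plain words: lists of blocks need no casts between lengths.
splice : Word → Word → Word
splice w u = concat (zipWith _++_ (toList (split y w)) (toList (split x u)))

word-⊗ : ∀ {n m k} (w : P n m) (u : P m k) → word (w ⊗ u) ≡ splice (word w) (word u)
word-⊗ w@(mkP v p q) u@(mkP t r s) = trans (interleave-toList (blˣ w) (blʸ u))
  (cong₂ (λ vs us → concat (zipWith _++_ vs us))
    (toList-cast (cong suc q) (split y v)) (toList-cast (cong suc r) (split x t)))

-- A `y` of `w` meets an `x` of `u` and both vanish, which is what composes the counts. An `x`
-- heading `w` is emitted first; a `y` heading `u` is emitted once the current block of `w` is
-- empty. By the hypothesis both words run out of separators together.
xsBefore-splice : ∀ w u → occ y w ≡ occ x u → ∀ i →
                  xsBefore (splice w u) i ≡ xsBefore w (xsBefore u i)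
xsBefore-splice (x ∷ w) u eq i
  -- Exposing the first blocks lets `consHead` and the concatenation reduce.
  with split y w | split x u | xsBefore-splice w u eq i
... | _ ∷ _ | _ ∷ _ | ih = cong suc ih
xsBefore-splice (y ∷ w) (x ∷ u) eq i = xsBefore-splice w u (suc-injective eq) i
xsBefore-splice (y ∷ w) (y ∷ u) eq i
  with split x u | xsBefore-splice (y ∷ w) u eq
xsBefore-splice (y ∷ w) (y ∷ u) eq zero    | _ ∷ _ | ih = refl
xsBefore-splice (y ∷ w) (y ∷ u) eq (suc i) | _ ∷ _ | ih = ih i
xsBefore-splice [] [] eq i = refl
xsBefore-splice [] (y ∷ u) eq i
  with split x u | xsBefore-splice [] u eq
xsBefore-splice [] (y ∷ u) eq zero    | _ ∷ _ | ih = refl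
xsBefore-splice [] (y ∷ u) eq (suc i) | _ ∷ _ | ih = ih i

word-injective : ∀ {n m} {v w : P n m} → word v ≡ word w → v ≡ w
word-injective refl = refl

occˣ-word : ∀ {n m} (w : P n m) → occ x (word w) ≡ n
occˣ-word {n} (mkP w p _) = recompute (occ x w ℕ.≟ n) p

occʸ-word : ∀ {n m} (w : P n m) → occ y (word w) ≡ m
occʸ-word {m = m} (mkP w _ q) = recompute (occ y w ℕ.≟ m) q

Idempotent : (ℕ → ℕ) → Set
Idempotent g = ∀ i → g (g i) ≡ g i

⊗-idempotent : ∀ {n} (w : P n n) → (w ⊗ w ≡ w) ⇔ Idempotent (xsBefore (word w))
⊗-idempotent w = mk⇔
  (λ eq i → trans (sym (xsBefore-⊗ i)) (cong (λ v → xsBefore (word v) i) eq))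
  (λ idem → word-injective (xsBefore-injective (word (w ⊗ w)) (word w)
    (trans (occʸ-word (w ⊗ w)) (sym (occʸ-word w)))
    (λ i → trans (xsBefore-⊗ i) (idem i))))
  where
  xsBefore-⊗ : ∀ i → xsBefore (word (w ⊗ w)) i ≡ xsBefore (word w) (xsBefore (word w) i)
  xsBefore-⊗ i = trans (cong (λ v → xsBefore v i) (word-⊗ w w))
    (xsBefore-splice (word w) (word w) (trans (occʸ-word w) (sym (occˣ-word w))) i)

last-∷ʳ : ∀ (p : Word) c → last (p ++ [ c ]) ≡ just c
last-∷ʳ []          c = refl
last-∷ʳ (_ ∷ [])    c = refl
last-∷ʳ (_ ∷ e ∷ p) c = last-∷ʳ (e ∷ p) c

last-just : ∀ (w : Word) {c} → last w ≡ just c → ∃ λ p → w ≡ p ++ [ c ]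
last-just (e ∷ [])    refl = [] , refl
last-just (e ∷ f ∷ w) eq   with last-just (f ∷ w) eq
... | p , eq′ = e ∷ p , cong (e ∷_) eq′

-- The coordinates stay sums so that for a concrete `c` they compute to `+ 0` and `+ 1`, the form
-- used for corners below.
corner⇒turn : ∀ {c d} p q →
              Turn c d (p ++ c ∷ d ∷ q) (occ x p + occ x [ c ]) (occ y p + occ y [ c ])
corner⇒turn {c} {d} p q = p ++ [ c ] , d ∷ q ,
  sym (++-assoc p [ c ] (d ∷ q)) , last-∷ʳ p c , refl , occ-++ x p [ c ] , occ-++ y p [ c ]

turn⇒corner : ∀ {c d w a b} → Turn c d w a b →
              ∃₂ λ p q → w ≡ p ++ c ∷ d ∷ q × occ x p + occ x [ c ] ≡ a × occ y p + occ y [ c ] ≡ b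
turn⇒corner {c} (w₀ , d ∷ q , refl , lst , refl , refl , refl) with last-just w₀ lst
... | p , refl = p , q , ++-assoc p [ c ] (d ∷ q) , sym (occ-++ x p [ c ]) , sym (occ-++ y p [ c ])

-- The `y` ending at the turn has index `c`; the `x` that follows it is counted from index `suc c`
-- on.
northEast⇒rise : ∀ {w a b} → NorthEastTurn w a b →
                 ∃ λ c → b ≡ suc c × xsBefore w c ≡ a × a < xsBefore w (suc c)
northEast⇒rise t with turn⇒corner t
... | p , q , refl , refl , refl = occ y p , +-comm (occ y p) 1 ,
  trans (cong (xsBefore (p ++ y ∷ x ∷ q)) (sym (+-identityʳ _))) (xsBefore-++ p (y ∷ x ∷ q) 0) ,
  subst (_ <_)
    (sym (trans (cong (xsBefore (p ++ y ∷ x ∷ q)) (+-comm 1 (occ y p))) (xsBefore-++ p (y ∷ x ∷ q) 1)))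
    (+-monoʳ-< (occ x p) (s≤s z≤n))

-- The `y` leaving the turn has index `b`. All earlier `y`'s lie before the `x` that enters the
-- turn, so they miss that `x`.
eastNorth⇒first : ∀ {w a b} → EastNorthTurn w a b →
                  xsBefore w b ≡ a × (∀ {i} → i < b → xsBefore w i < a)
eastNorth⇒first t with turn⇒corner t
... | p , q , refl , refl , refl = xsBefore-++ p (x ∷ y ∷ q) 0 , λ i<b →
  <-≤-trans
    (s≤s (xsBefore-++-≤ p (x ∷ y ∷ q) (<-≤-trans i<b (≤-reflexive (+-identityʳ (occ y p))))))
    (≤-reflexive (+-comm 1 (occ x p)))

-- Some `x` follows the `y` of index `i`. The last `y` before the next such `x` has the same
-- abscissa and forms the corner.
northEast-corner : ∀ w i → xsBefore w i < occ x w →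
                   ∃₂ λ p q → w ≡ p ++ y ∷ x ∷ q × occ x p + 0 ≡ xsBefore w i
northEast-corner (x ∷ w) i (s≤s lt) with northEast-corner w i lt
... | p , q , refl , eq = x ∷ p , q , refl , cong suc eq
northEast-corner (y ∷ w) (suc i) lt with northEast-corner w i lt
... | p , q , refl , eq = y ∷ p , q , refl , eq
northEast-corner (y ∷ x ∷ w) zero lt = [] , w , refl , refl
northEast-corner (y ∷ y ∷ w) zero lt with northEast-corner (y ∷ w) zero lt
... | p , q , eq′ , eq = y ∷ p , q , cong (y ∷_) eq′ , eq

-- The corner is formed by the last `x` before the `y` of index `i` and the `y` right after that
-- `x`.
eastNorth-corner : ∀ w i → i < occ y w → 0 < xsBefore w i →
                   ∃₂ λ p q → w ≡ p ++ x ∷ y ∷ q × occ x p + 1 ≡ xsBefore w i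
eastNorth-corner (y ∷ w) (suc i) (s≤s i<w) pos with eastNorth-corner w i i<w pos
... | p , q , refl , eq = y ∷ p , q , refl , eq
eastNorth-corner (x ∷ x ∷ w) i i<w _ with eastNorth-corner (x ∷ w) i i<w (s≤s z≤n)
... | p , q , eq′ , eq = x ∷ p , q , cong (x ∷_) eq′ , cong suc eq
eastNorth-corner (x ∷ y ∷ w) zero _ _ = [] , w , refl , refl
-- This corner is the right one only if no further `x` precedes the `y` of index `i` in the rest;
-- otherwise the search goes on there.
eastNorth-corner (x ∷ y ∷ w) (suc i) (s≤s i<w) _ with xsBefore w i in eq₀
... | zero  = [] , w , refl , refl
... | suc k with eastNorth-corner w i i<w (subst (0 <_) (sym eq₀) (s≤s z≤n))
...   | p , q , refl , eq = x ∷ y ∷ p , q , refl , cong suc (trans eq eq₀)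

northEast-exists : ∀ w i → xsBefore w i < occ x w → ∃ λ b → NorthEastTurn w (xsBefore w i) b
northEast-exists w i lt with northEast-corner w i lt
... | p , q , eq′ , eq =
  occ y p + 1 , subst₂ (λ v a → NorthEastTurn v a (occ y p + 1)) (sym eq′) eq (corner⇒turn p q)

eastNorth-exists : ∀ w i → i < occ y w → 0 < xsBefore w i →
                   ∃ λ b → EastNorthTurn w (xsBefore w i) b
eastNorth-exists w i i<w pos with eastNorth-corner w i i<w pos
... | p , q , eq′ , eq =
  occ y p + 0 , subst₂ (λ v a → EastNorthTurn v a (occ y p + 0)) (sym eq′) eq (corner⇒turn p q)

numerator-+½ : ∀ a → (ℚᵘ.↥ (fromℕ a ℚᵘ.+ ½)) ℤ.* + 1 ≡ + (suc (a * 2))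
numerator-+½ a = trans (ℤ-*-identityʳ _)
  (trans (cong (ℤ._+ + 1) (sym (pos-* a 2))) (cong +_ (+-comm (a * 2) 1)))

-- Cleared of denominators, the inequality reads 2a + 1 < 2b, which for integers means a < b.
aboveLine : ∀ a b → AboveLine a b ⇔ a < b
aboveLine a b = mk⇔
  (λ { (*<* lt) → *-cancelʳ-< 2 a b (<-trans (n<1+n _)
    (drop‿+<+ (subst₂ ℤ._<_ (numerator-+½ a) (sym (pos-* b 2)) lt))) })
  (λ a<b → *<* (subst₂ ℤ._<_ (sym (numerator-+½ a)) (pos-* b 2) (+<+ (*-monoˡ-≤ 2 a<b))))

belowLine : ∀ a b → BelowLine a b ⇔ b ≤ a
belowLine a b = mk⇔
  (λ { (*<* lt) → *-cancelʳ-≤ b a 2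
    (s≤s⁻¹ (drop‿+<+ (subst₂ ℤ._<_ (sym (pos-* b 2)) (numerator-+½ a) lt))) })
  (λ b≤a → *<* (subst₂ ℤ._<_ (pos-* b 2) (sym (numerator-+½ a)) (+<+ (s≤s (*-monoˡ-≤ 2 b≤a)))))

idempotent⇒zigzag : ∀ {n m} (w : P n m) → Idempotent (xsBefore (word w)) → UpperZigzag w
idempotent⇒zigzag w idem =
  (λ a b t → Equivalence.from (aboveLine a b) (above t)) ,
  (λ a b t → Equivalence.from (belowLine a b) (below t))
  where
  g = xsBefore (word w)

  above : ∀ {a b} → NorthEastTurn (word w) a b → a < b
  above t with northEast⇒rise t
  -- If c + 1 ≤ g c, then g (c + 1) ≤ g (g c) = g c, against the rise at c.
  ... | c , refl , refl , rise = ≰⇒> λ 1+c≤gc →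
    <⇒≱ rise (≤-trans (xsBefore-mono (word w) 1+c≤gc) (≤-reflexive (idem c)))

  below : ∀ {a b} → EastNorthTurn (word w) a b → b ≤ a
  below {b = b} t with eastNorth⇒first t
  -- If g b < b, minimality of b at the argument g b gives g (g b) < g b.
  ... | refl , first = ≮⇒≥ λ gb<b → <⇒≢ (first gb<b) (idem b)

zigzag⇒idempotent : ∀ {n} (w : P n n) → UpperZigzag w → Idempotent (xsBefore (word w))
zigzag⇒idempotent {n} w (above , below) i = ≤-antisym ggi≤gi gi≤ggi
  where
  g = xsBefore (word w)

  ggi≤gi : g (g i) ≤ g i
  ggi≤gi with g i ℕ.<? occ x (word w)
  ... | no  gi≮n = ≤-trans (xsBefore-≤ (word w) (g i)) (≮⇒≥ gi≮n)
  ... | yes gi<n with northEast-exists (word w) i gi<n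
  ...   | b , t with Equivalence.to (aboveLine (g i) b) (above (g i) b t) | northEast⇒rise t
  -- The turn gives g i ≤ c with g c = g i, so monotonicity bounds g (g i) from above.
  ...     | gi<b | c , refl , gc≡gi , _ =
    ≤-trans (xsBefore-mono (word w) (s≤s⁻¹ gi<b)) (≤-reflexive gc≡gi)

  gi≤ggi : g i ≤ g (g i)
  gi≤ggi with i ℕ.<? occ y (word w) | 0 ℕ.<? g i
  ... | _ | no gi≯0 = ≤-trans (≮⇒≥ gi≯0) z≤n
  -- Past the last `y` the value g i is the number of `x`'s. In P(n,n) this is also the number of
  -- `y`'s, so g takes its final value there and fixes it.
  ... | no i≮n | yes _ = ≤-reflexive (sym (trans (xsBefore-total (word w) n≤gi) (sym gi≡n)))
    where
    gi≡n : g i ≡ occ x (word w)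
    gi≡n = xsBefore-total (word w) (≮⇒≥ i≮n)
    n≤gi : occ y (word w) ≤ g i
    n≤gi = ≤-reflexive (trans (occʸ-word w) (sym (trans gi≡n (occˣ-word w))))
  ... | yes i<n | yes gi>0 with eastNorth-exists (word w) i i<n gi>0
  ...   | b , t with eastNorth⇒first t
  -- Dually, the turn gives b ≤ g i with g b = g i.
  ...     | gb≡gi , _ = ≤-trans (≤-reflexive (sym gb≡gi))
    (xsBefore-mono (word w) (Equivalence.to (belowLine (g i) b) (below (g i) b t)))

theorem2 : ∀ (n : ℕ) (w : P n n) → (w ⊗ w ≡ w) ⇔ UpperZigzag w
theorem2 n w = mk⇔
  (idempotent⇒zigzag w ∘ Equivalence.to (⊗-idempotent w))
  (Equivalence.from (⊗-idempotent w) ∘ zigzag⇒idempotent w)
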